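{- Almost all finite simple graphs have a $Deg$-mate. That is, if $\mathcal{G}(n)$ denotes the set of isomorphism classes of simple graphs on $n$ vertices and $U_{Deg}(n)\subseteq \mathcal{G}(n)$ the set of those $G$ which are $Deg$-unique, then $\lim_{n\to\infty} |U_{Deg}(n)|/|\mathcal{G}(n)| = 0$.
   Context: All graphs are finite, simple (undirected, no loops, no parallel edges). For a graph $G=(V,E)$ and $v\in V$, $\deg(v)$ is the degree of $v$. The degree polynomial is $Deg(G;x)=\sum_{v\in V} x^{\deg(v)}$. For a graph polynomial $P$ (a map assigning to each graph a polynomial, invariant under isomorphism), a graph $H$ is a $P$-mate of $G$ if $P(G)=P(H)$ but $H$ is not isomorphic to $G$; $G$ is $P$-unique if it has no $P$-mate. "Almost all graphs" means the proportion of (isomorphism classes of) graphs of order $n$ with the property tends to $1$ as $n\to\infty$. -}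

module Defs where

open import Algebra.Bundles using (CommutativeMonoid)
import Algebra.Properties.CommutativeMonoid.Sum as MonoidSum
open import Data.Bool using (Bool; true; false; not; _∧_; if_then_else_)
import Data.Bool as Bool
open import Data.Bool.Properties using (∧-comm; ∧-idem)
open import Data.Fin using (Fin; zero; suc)
import Data.Fin as Fin
import Data.Fin.Properties as Fin
open import Data.Fin.Permutation as Perm using (Permutation; _⟨$⟩ʳ_; _⟨$⟩ˡ_; ↔⇒≡)
open import Data.Fin.Subset using (Subset; ∣_∣)
open import Data.Integer using (ℤ; +_)
import Data.Integer as ℤ
import Data.Integer.Properties as ℤ
open import Data.List using (List; []; _∷_; map; allFin; cartesianProduct; cartesianProductWith; deduplicate; length; lookup)
open import Data.List.Membership.Propositional using (_∈_; find; lose)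
open import Data.List.Membership.Propositional.Properties using (∈-lookup; ∈-allFin; ∈-cartesianProduct⁺; ∈-cartesianProductWith⁺)
open import Data.List.Relation.Unary.All as All using (_∷_)
open import Data.List.Relation.Unary.AllPairs using (_∷_)
open import Data.List.Relation.Unary.Any as Any using (Any; here; there; any?)
import Data.List.Relation.Unary.Any.Properties as Any
import Data.List.Relation.Unary.Enumerates.Setoid as Enumerates
import Data.List.Relation.Unary.Enumerates.Setoid.Properties as Enumerates
import Data.List.Relation.Unary.Unique.Setoid as UniqueList
open import Data.List.Relation.Unary.Unique.DecSetoid.Properties using (deduplicate-!)
open import Data.Nat using (ℕ; zero; suc; NonZero)
import Data.Nat as ℕ
import Data.Nat.Properties as ℕ
open import Data.Product using (Σ; ∃; _×_; _,_; proj₁; proj₂)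
open import Data.Rational using (ℚ; 0ℚ; 1ℚ)
import Data.Rational as ℚ
open import Data.Vec using (Vec; []; _∷_; tabulate)
import Data.Vec as Vec
import Data.Vec.Properties as Vec
open import Function using (_∘_)
open import Function.Bundles using (Bijection)
open import Level using (0ℓ)
open import Relation.Binary using (Setoid; DecSetoid)
import Relation.Binary.Construct.On as On
open import Relation.Binary.PropositionalEquality as ≡ using (_≡_; refl; sym; trans; cong; cong₂)
open import Relation.Nullary using (¬_; Dec; yes; no; does; contradiction)
open import Relation.Nullary.Decidable using (map′; _×-dec_; ¬?; dec-true; dec-false)

private
  variable
    l m n : ℕ

record Graph (n : ℕ) : Set where
  field
    adj       : Fin n → Fin n → Bool
    symmetric : ∀ u v → adj u v ≡ adj v u
    loopless  : ∀ v → adj v v ≡ false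

open Graph public

record _≅_ (G : Graph m) (H : Graph n) : Set where
  field
    bij      : Permutation m n
    adj-pres : ∀ u v → adj G u v ≡ adj H (bij ⟨$⟩ʳ u) (bij ⟨$⟩ʳ v)

open _≅_ public

infix 4 _≅_

≅-refl : {G : Graph n} → G ≅ G
≅-refl = record { bij = Perm.id ; adj-pres = λ _ _ → refl }

≅-sym : {G : Graph m} {H : Graph n} → G ≅ H → H ≅ G
≅-sym {G = G} {H} i = record
  { bij      = Perm.flip (bij i)
  ; adj-pres = λ u v → sym (trans (adj-pres i _ _)
      (cong₂ (adj H) (Perm.inverseʳ (bij i)) (Perm.inverseʳ (bij i))))
  }

≅-trans : {G : Graph l} {H : Graph m} {K : Graph n} → G ≅ H → H ≅ K → G ≅ K
≅-trans i j = record
  { bij      = bij i Perm.∘ₚ bij j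
  ; adj-pres = λ u v → trans (adj-pres i u v) (adj-pres j _ _)
  }

-- Quotients are represented by setoids: the elements of 𝒢 n "are" the
-- isomorphism classes of simple graphs on n vertices.
𝒢 : ℕ → Setoid 0ℓ 0ℓ
𝒢 n = record
  { Carrier       = Graph n
  ; _≈_           = _≅_
  ; isEquivalence = record { refl = ≅-refl ; sym = ≅-sym ; trans = ≅-trans }
  }

neighbours : Graph n → Fin n → Subset n
neighbours G v = tabulate (adj G v)

deg : Graph n → Fin n → ℕ
deg G v = ∣ neighbours G v ∣

-- Polynomials with integer coefficients, as coefficient lists with the
-- constant coefficient first.  Trailing zeros are allowed, so equality of
-- polynomials is _≈_, not _≡_.

ℤ[x] : Set
ℤ[x] = List ℤ

coeff : ℤ[x] → ℕ → ℤ
coeff []      _       = + 0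
coeff (a ∷ p) zero    = a
coeff (a ∷ p) (suc k) = coeff p k

record _≈_ (p q : ℤ[x]) : Set where
  constructor mk≈
  field
    coeff-≡ : ∀ k → coeff p k ≡ coeff q k

open _≈_ public

infix 4 _≈_

_⊕_ : ℤ[x] → ℤ[x] → ℤ[x]
[]      ⊕ q       = q
(a ∷ p) ⊕ []      = a ∷ p
(a ∷ p) ⊕ (b ∷ q) = (a ℤ.+ b) ∷ (p ⊕ q)

infixl 6 _⊕_

x^_ : ℕ → ℤ[x]
x^ zero  = + 1 ∷ []
x^ suc k = + 0 ∷ x^ k

coeff-⊕ : ∀ p q k → coeff (p ⊕ q) k ≡ coeff p k ℤ.+ coeff q k
coeff-⊕ []      q       k       = sym (ℤ.+-identityˡ _)
coeff-⊕ (a ∷ p) []      k       = sym (ℤ.+-identityʳ _)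
coeff-⊕ (a ∷ p) (b ∷ q) zero    = refl
coeff-⊕ (a ∷ p) (b ∷ q) (suc k) = coeff-⊕ p q k

⊕-commutativeMonoid : CommutativeMonoid 0ℓ 0ℓ
⊕-commutativeMonoid = record
  { Carrier = ℤ[x]
  ; _≈_ = _≈_
  ; _∙_ = _⊕_
  ; ε = []
  ; isCommutativeMonoid = record
    { isMonoid = record
      { isSemigroup = record
        { isMagma = record
          { isEquivalence = record
            { refl  = mk≈ λ _ → refl
            ; sym   = λ e → mk≈ λ k → sym (coeff-≡ e k)
            ; trans = λ e f → mk≈ λ k → trans (coeff-≡ e k) (coeff-≡ f k)
            }
          ; ∙-cong = λ {p} {p′} {q} {q′} e f → mk≈ λ k →
              trans (coeff-⊕ p q k)
                (trans (cong₂ ℤ._+_ (coeff-≡ e k) (coeff-≡ f k)) (sym (coeff-⊕ p′ q′ k)))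
          }
        ; assoc = λ p q r → mk≈ λ k →
            trans (coeff-⊕ (p ⊕ q) r k)
              (trans (cong (ℤ._+ coeff r k) (coeff-⊕ p q k))
                (trans (ℤ.+-assoc (coeff p k) (coeff q k) (coeff r k))
                  (trans (cong (λ z → coeff p k ℤ.+ z) (sym (coeff-⊕ q r k)))
                    (sym (coeff-⊕ p (q ⊕ r) k)))))
        }
      ; identity = (λ p → mk≈ λ _ → refl)
                 , (λ p → mk≈ λ k → trans (coeff-⊕ p [] k) (ℤ.+-identityʳ _))
      }
    ; comm = λ p q → mk≈ λ k →
        trans (coeff-⊕ p q k)
          (trans (ℤ.+-comm (coeff p k) (coeff q k)) (sym (coeff-⊕ q p k)))
    }
  }

open CommutativeMonoid ⊕-commutativeMonoid public
  using () renaming (refl to ≈-refl; sym to ≈-sym; trans to ≈-trans)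

∑ₚ : (Fin n → ℤ[x]) → ℤ[x]
∑ₚ = MonoidSum.sum ⊕-commutativeMonoid

_≈?_ : ∀ p q → Dec (p ≈ q)
[] ≈? [] = yes ≈-refl
[] ≈? (b ∷ q) =
  map′ (λ (e , f) → mk≈ λ { zero → e ; (suc k) → coeff-≡ f k })
       (λ e → coeff-≡ e 0 , mk≈ λ k → coeff-≡ e (suc k))
       ((+ 0 ℤ.≟ b) ×-dec ([] ≈? q))
(a ∷ p) ≈? [] =
  map′ (λ (e , f) → mk≈ λ { zero → e ; (suc k) → coeff-≡ f k })
       (λ e → coeff-≡ e 0 , mk≈ λ k → coeff-≡ e (suc k))
       ((a ℤ.≟ + 0) ×-dec (p ≈? []))
(a ∷ p) ≈? (b ∷ q) =
  map′ (λ (e , f) → mk≈ λ { zero → e ; (suc k) → coeff-≡ f k })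
       (λ e → coeff-≡ e 0 , mk≈ λ k → coeff-≡ e (suc k))
       ((a ℤ.≟ b) ×-dec (p ≈? q))

record GraphPolynomial : Set where
  field
    ⟦_⟧       : Graph n → ℤ[x]
    invariant : {G : Graph m} {H : Graph n} → G ≅ H → ⟦ G ⟧ ≈ ⟦ H ⟧

open GraphPolynomial public

-- The order of the mate H is not assumed to be that of G.
IsMate : GraphPolynomial → Graph m → Graph n → Set
IsMate P G H = ⟦ P ⟧ G ≈ ⟦ P ⟧ H × ¬ (H ≅ G)

HasMate : GraphPolynomial → Graph n → Set
HasMate P G = ∃ λ m → Σ (Graph m) (IsMate P G)

IsUnique : GraphPolynomial → Graph n → Set
IsUnique P G = ¬ HasMate P G

degreePolynomial : Graph n → ℤ[x]
degreePolynomial G = ∑ₚ (λ v → x^ deg G v)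

private
  ∑ℕ : (Fin n → ℕ) → ℕ
  ∑ℕ = MonoidSum.sum ℕ.+-0-commutativeMonoid

  size-tabulate : (f : Fin n → Bool) → ∣ tabulate f ∣ ≡ ∑ℕ (λ i → if f i then 1 else 0)
  size-tabulate {zero}  f = refl
  size-tabulate {suc n} f with f zero
  ... | true  = cong suc (size-tabulate (f ∘ suc))
  ... | false = size-tabulate (f ∘ suc)

deg-pres : {G : Graph m} {H : Graph n} (i : G ≅ H) →
           ∀ v → deg G v ≡ deg H (bij i ⟨$⟩ʳ v)
deg-pres {G = G} {H} i v =
  trans (size-tabulate (adj G v))
    (trans (MonoidSum.sum-cong-≗ ℕ.+-0-commutativeMonoid
             (λ w → cong (λ b → if b then 1 else 0) (adj-pres i v w)))
      (trans (sym (MonoidSum.sum-permute ℕ.+-0-commutativeMonoid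
               (λ w → if adj H (bij i ⟨$⟩ʳ v) w then 1 else 0) (bij i)))
        (sym (size-tabulate (adj H (bij i ⟨$⟩ʳ v))))))

Deg : GraphPolynomial
Deg = record
  { ⟦_⟧       = degreePolynomial
  ; invariant = λ {_} {_} {G} {H} i → ≈-trans
      (CommutativeMonoid.reflexive ⊕-commutativeMonoid
        (MonoidSum.sum-cong-≗ ⊕-commutativeMonoid (λ v → cong x^_ (deg-pres i v))))
      (≈-sym (MonoidSum.sum-permute ⊕-commutativeMonoid (λ w → x^ deg H w) (bij i)))
  }

-- Elements are counted up to the setoid's equality, i.e. classes are counted.
HasCardinality : Setoid 0ℓ 0ℓ → ℕ → Set
HasCardinality S k = Bijection (≡.setoid (Fin k)) S

Finite : Setoid 0ℓ 0ℓ → Set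
Finite S = ∃ (HasCardinality S)

card : {S : Setoid 0ℓ 0ℓ} → Finite S → ℕ
card = proj₁

private
  module _ (S : Setoid 0ℓ 0ℓ) where
    open Setoid S using () renaming (sym to ≈ˢ-sym; _≈_ to _≈ˢ_)

    lookup-injective : ∀ {xs} → UniqueList.Unique S xs →
                       ∀ {i j} → lookup xs i ≈ˢ lookup xs j → i ≡ j
    lookup-injective (px ∷ u) {zero}  {zero}  e = refl
    lookup-injective (px ∷ u) {zero}  {suc j} e =
      contradiction e (All.lookup px (∈-lookup j))
    lookup-injective (px ∷ u) {suc i} {zero}  e =
      contradiction (≈ˢ-sym e) (All.lookup px (∈-lookup i))
    lookup-injective (px ∷ u) {suc i} {suc j} e = cong suc (lookup-injective u e)

finite : (S : DecSetoid 0ℓ 0ℓ) → let open DecSetoid S in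
         ∀ xs → Enumerates.IsEnumeration setoid xs → Finite setoid
finite S xs enum = length ys , record
  { to        = lookup ys
  ; cong      = λ { refl → DecSetoid.refl S }
  ; bijective = lookup-injective (DecSetoid.setoid S) (deduplicate-! S xs)
              , Enumerates.lookup-surjective (DecSetoid.setoid S) (Enumerates.deduplicate⁺ S enum)
  }
  where ys = deduplicate (DecSetoid._≟_ S) xs

private
  vecs : {A : Set} → List A → ∀ n → List (Vec A n)
  vecs xs zero    = [] ∷ []
  vecs xs (suc n) = cartesianProductWith _∷_ xs (vecs xs n)

  ∈-vecs : {A : Set} {xs : List A} → (∀ x → x ∈ xs) → (v : Vec A n) → v ∈ vecs xs n
  ∈-vecs all []      = here refl
  ∈-vecs all (x ∷ v) = ∈-cartesianProductWith⁺ _∷_ (all x) (∈-vecs all v)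

  Maps : ℕ → Set
  Maps n = Vec (Fin n) n × Vec (Fin n) n

  maps : ∀ n → List (Maps n)
  maps n = cartesianProduct (vecs (allFin n) n) (vecs (allFin n) n)

  IsoMaps : Graph n → Graph n → Maps n → Set
  IsoMaps G H (f , g) =
      (∀ i → Vec.lookup f (Vec.lookup g i) ≡ i)
    × (∀ i → Vec.lookup g (Vec.lookup f i) ≡ i)
    × (∀ u v → adj G u v ≡ adj H (Vec.lookup f u) (Vec.lookup f v))

  isoMaps? : (G H : Graph n) → ∀ fg → Dec (IsoMaps G H fg)
  isoMaps? G H (f , g) =
    Fin.all? (λ i → _ Fin.≟ i) ×-dec
    (Fin.all? (λ i → _ Fin.≟ i) ×-dec
     Fin.all? (λ u → Fin.all? (λ v → _ Bool.≟ _)))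

_≅?_ : (G H : Graph n) → Dec (G ≅ H)
_≅?_ {n} G H = map′ to from (any? (isoMaps? G H) (maps n))
  where
  to : Any (IsoMaps G H) (maps n) → G ≅ H
  to p with (f , g) , _ , fg , gf , pres ← find p = record
    { bij = Perm.permutation (Vec.lookup f) (Vec.lookup g) fg gf ; adj-pres = pres }

  from : G ≅ H → Any (IsoMaps G H) (maps n)
  from i = lose
    (∈-cartesianProduct⁺ (∈-vecs ∈-allFin (tabulate f)) (∈-vecs ∈-allFin (tabulate g)))
    ( (λ k → trans (cong (Vec.lookup (tabulate f)) (Vec.lookup∘tabulate g k))
               (trans (Vec.lookup∘tabulate f _) (Perm.inverseʳ (bij i))))
    , (λ k → trans (cong (Vec.lookup (tabulate g)) (Vec.lookup∘tabulate f k))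
               (trans (Vec.lookup∘tabulate g _) (Perm.inverseˡ (bij i))))
    , (λ u v → trans (adj-pres i u v)
         (sym (cong₂ (adj H) (Vec.lookup∘tabulate f u) (Vec.lookup∘tabulate f v)))))
    where
    f = bij i ⟨$⟩ʳ_
    g = bij i ⟨$⟩ˡ_

𝒢-dec : ℕ → DecSetoid 0ℓ 0ℓ
𝒢-dec n = record
  { Carrier = Graph n
  ; _≈_ = _≅_
  ; isDecEquivalence = record { isEquivalence = Setoid.isEquivalence (𝒢 n) ; _≟_ = _≅?_ }
  }

private
  Matrix : ℕ → Set
  Matrix n = Vec (Vec Bool n) n

  entry : Matrix n → Fin n → Fin n → Bool
  entry M u v = Vec.lookup (Vec.lookup M u) v

  distinct : Fin n → Fin n → Bool
  distinct u v = not (does (u Fin.≟ v))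

  distinct-sym : (u v : Fin n) → distinct u v ≡ distinct v u
  distinct-sym u v with u Fin.≟ v
  ... | yes refl = sym (cong not (dec-true (u Fin.≟ u) refl))
  ... | no u≢v   = sym (cong not (dec-false (v Fin.≟ u) (u≢v ∘ sym)))

  fromMatrix : Matrix n → Graph n
  fromMatrix M = record
    { adj       = λ u v → distinct u v ∧ (entry M u v ∧ entry M v u)
    ; symmetric = λ u v → cong₂ _∧_ (distinct-sym u v) (∧-comm (entry M u v) (entry M v u))
    ; loopless  = λ v → cong (λ b → not b ∧ (entry M v v ∧ entry M v v))
                          (dec-true (v Fin.≟ v) refl)
    }

  toMatrix : Graph n → Matrix n
  toMatrix G = tabulate (λ u → tabulate (adj G u))

  entry-toMatrix : (G : Graph n) → ∀ u v → entry (toMatrix G) u v ≡ adj G u v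
  entry-toMatrix G u v =
    trans (cong (λ r → Vec.lookup r v) (Vec.lookup∘tabulate (λ u → tabulate (adj G u)) u))
          (Vec.lookup∘tabulate (adj G u) v)

  distinct-adj : (G : Graph n) → ∀ u v → adj G u v ≡ distinct u v ∧ adj G u v
  distinct-adj G u v with u Fin.≟ v
  ... | yes refl = loopless G u
  ... | no _     = refl

  from∘toMatrix : (G : Graph n) → G ≅ fromMatrix (toMatrix G)
  from∘toMatrix G = record
    { bij      = Perm.id
    ; adj-pres = λ u v → trans (distinct-adj G u v) (cong (distinct u v ∧_)
        (trans (sym (∧-idem (adj G u v)))
          (sym (cong₂ _∧_ (entry-toMatrix G u v)
            (trans (entry-toMatrix G v u) (symmetric G v u))))))
    }

  bools : List Bool
  bools = true ∷ false ∷ []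

  ∈-bools : ∀ b → b ∈ bools
  ∈-bools true  = here refl
  ∈-bools false = there (here refl)

  graphs : ∀ n → List (Graph n)
  graphs n = map fromMatrix (vecs (vecs bools n) n)

  graphs-enumerates : ∀ n → Enumerates.IsEnumeration (𝒢 n) (graphs n)
  graphs-enumerates n G = Any.map⁺ (Any.map (λ { refl → from∘toMatrix G })
    (∈-vecs (∈-vecs ∈-bools) (toMatrix G)))

𝒢-finite : ∀ n → Finite (𝒢 n)
𝒢-finite n = finite (𝒢-dec n) (graphs n) (graphs-enumerates n)

∣𝒢∣ : ℕ → ℕ
∣𝒢∣ n = card (𝒢-finite n)

emptyGraph : ∀ n → Graph n
emptyGraph n = record { adj = λ _ _ → false ; symmetric = λ _ _ → refl ; loopless = λ _ → refl }

∣𝒢∣-nonZero : ∀ n → NonZero (∣𝒢∣ n)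
∣𝒢∣-nonZero n = Fin.nonZeroIndex (Bijection.surjective (proj₂ (𝒢-finite n)) (emptyGraph n) .proj₁)

record GraphProperty : Set₁ where
  field
    Holds    : Graph n → Set
    respects : {G H : Graph n} → G ≅ H → Holds G → Holds H
    holds?   : (G : Graph n) → Dec (Holds G)

open GraphProperty public

-- The isomorphism classes of order n with property Q; the proof of Q is
-- ignored by the equality, so each class counts once.
_∩𝒢_ : GraphProperty → ℕ → Setoid 0ℓ 0ℓ
Q ∩𝒢 n = On.setoid {B = Σ (Graph n) (Holds Q)} (𝒢 n) proj₁

private
  module _ (Q : GraphProperty) where
    select : List (Graph n) → List (Σ (Graph n) (Holds Q))
    select []       = []
    select (G ∷ Gs) with holds? Q G
    ... | yes q = (G , q) ∷ select Gs
    ... | no _  = select Gs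

    select⁺ : (Gs : List (Graph n)) (H : Graph n) → Holds Q H →
              Any (λ G → H ≅ G) Gs → Any (λ K → H ≅ proj₁ K) (select Gs)
    select⁺ (G ∷ Gs) H h p with holds? Q G | p
    ... | yes q | here i  = here i
    ... | yes q | there r = there (select⁺ Gs H h r)
    ... | no ¬q | here i  = contradiction (respects Q i h) ¬q
    ... | no ¬q | there r = select⁺ Gs H h r

∩𝒢-finite : ∀ Q n → Finite (Q ∩𝒢 n)
∩𝒢-finite Q n = finite (On.decSetoid (𝒢-dec n) proj₁) (select Q (graphs n))
  (λ (H , h) → select⁺ Q (graphs n) H h (graphs-enumerates n H))

count : GraphProperty → ℕ → ℕ
count Q n = card (∩𝒢-finite Q n)

proportion : GraphProperty → ℕ → ℚ
proportion Q n = ℚ._/_ (+ count Q n) (∣𝒢∣ n) {{∣𝒢∣-nonZero n}}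

-- A mate may a priori have any order, but evaluating Deg at x = 1 gives the
-- order of the graph, so the search for a Deg-mate is finite.

private
  eval₁ : ℤ[x] → ℤ
  eval₁ []      = + 0
  eval₁ (a ∷ p) = a ℤ.+ eval₁ p

  eval₁-≈[] : ∀ q → [] ≈ q → + 0 ≡ eval₁ q
  eval₁-≈[] []      e = refl
  eval₁-≈[] (b ∷ q) e = cong₂ ℤ._+_ (coeff-≡ e 0) (eval₁-≈[] q (mk≈ λ k → coeff-≡ e (suc k)))

  eval₁-cong : ∀ p q → p ≈ q → eval₁ p ≡ eval₁ q
  eval₁-cong []      q       e = eval₁-≈[] q e
  eval₁-cong (a ∷ p) []      e = sym (eval₁-≈[] (a ∷ p) (≈-sym e))
  eval₁-cong (a ∷ p) (b ∷ q) e =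
    cong₂ ℤ._+_ (coeff-≡ e 0) (eval₁-cong p q (mk≈ λ k → coeff-≡ e (suc k)))

  eval₁-x^-⊕ : ∀ k p → eval₁ (x^ k ⊕ p) ≡ + 1 ℤ.+ eval₁ p
  eval₁-x^-⊕ zero    []      = refl
  eval₁-x^-⊕ zero    (b ∷ p) = ℤ.+-assoc (+ 1) b (eval₁ p)
  eval₁-x^-⊕ (suc k) []      =
    trans (ℤ.+-identityˡ _) (trans (cong eval₁ (sym (⊕-[] (x^ k)))) (eval₁-x^-⊕ k []))
    where
    ⊕-[] : ∀ p → p ⊕ [] ≡ p
    ⊕-[] []      = refl
    ⊕-[] (_ ∷ _) = refl
  eval₁-x^-⊕ (suc k) (b ∷ p) =
    trans (cong₂ ℤ._+_ (ℤ.+-identityˡ b) (eval₁-x^-⊕ k p))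
      (trans (sym (ℤ.+-assoc b (+ 1) (eval₁ p)))
        (trans (cong (λ z → z ℤ.+ eval₁ p) (ℤ.+-comm b (+ 1)))
          (ℤ.+-assoc (+ 1) b (eval₁ p))))

  eval₁-∑ : (d : Fin n → ℕ) → eval₁ (∑ₚ (λ v → x^ d v)) ≡ + n
  eval₁-∑ {zero}  d = refl
  eval₁-∑ {suc n} d =
    trans (eval₁-x^-⊕ (d zero) (∑ₚ (λ v → x^ d (suc v)))) (cong (λ z → + 1 ℤ.+ z) (eval₁-∑ (d ∘ suc)))

Deg-order : (G : Graph m) (H : Graph n) → ⟦ Deg ⟧ G ≈ ⟦ Deg ⟧ H → m ≡ n
Deg-order G H e = ℤ.+-injective
  (trans (sym (eval₁-∑ (deg G))) (trans (eval₁-cong _ _ e) (eval₁-∑ (deg H))))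

HasMate-resp : ∀ P {G : Graph m} {H : Graph n} → G ≅ H → HasMate P G → HasMate P H
HasMate-resp P i (_ , K , e , ¬j) =
  _ , K , ≈-trans (≈-sym (invariant P i)) e , λ j → ¬j (≅-trans j (≅-sym i))

hasDegMate? : (G : Graph n) → Dec (HasMate Deg G)
hasDegMate? {n} G = map′ to from
  (any? (λ H → (⟦ Deg ⟧ G ≈? ⟦ Deg ⟧ H) ×-dec ¬? (H ≅? G)) (graphs n))
  where
  to : Any (IsMate Deg G) (graphs n) → HasMate Deg G
  to p with H , _ , mate ← find p = n , H , mate

  from : HasMate Deg G → Any (IsMate Deg G) (graphs n)
  from (_ , H , e , ¬i) with refl ← Deg-order G H e =
    Any.map (λ j → ≈-trans e (invariant Deg j) , λ k → ¬i (≅-trans j k)) (graphs-enumerates n H)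

hasDegMate : GraphProperty
hasDegMate = record
  { Holds = HasMate Deg ; respects = HasMate-resp Deg ; holds? = hasDegMate? }

isDegUnique : GraphProperty
isDegUnique = record
  { Holds    = IsUnique Deg
  ; respects = λ i u → u ∘ HasMate-resp Deg (≅-sym i)
  ; holds?   = λ G → ¬? (hasDegMate? G)
  }

∣U-Deg∣ : ℕ → ℕ
∣U-Deg∣ = count isDegUnique

_⟶_ : (ℕ → ℚ) → ℚ → Set
a ⟶ L = ∀ ε → 0ℚ ℚ.< ε → ∃ λ N → ∀ n → N ℕ.≤ n → ℚ.∣ a n ℚ.- L ∣ ℚ.< ε

infix 3 _⟶_

AlmostAll : GraphProperty → Set
AlmostAll Q = proportion Q ⟶ 1ℚ

{-# OPTIONS --safe #-}

-- A Deg-unique graph is determined up to isomorphism by its degree sequence,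
-- which is one of at most (n+1)ⁿ functions, so there are at most (n+1)ⁿ
-- Deg-unique classes.  On the other hand a labelled graph is determined by its
-- class together with an isomorphism to a representative, so there are at
-- least 2^(n(n-1)/2) / nⁿ classes.  The quotient of the two bounds tends to 0.

module Submission where

open import Defs
open import Algebra.Bundles using (CommutativeMonoid)
open import Algebra.Properties.CommutativeMonoid.Sum using (sum-cong-≗)
open import Data.Bool using (Bool; false)
open import Data.Fin using (Fin; zero; suc; combine; fromℕ<; funToFin; finToFun; join; quotient; remainder; splitAt)
open import Data.Fin.Permutation using (_⟨$⟩ʳ_)
open import Data.Fin.Properties using (2↔Bool; combine-injective; combine-remQuot; fromℕ<-injective; funToFin-finToFin; finToFun-funToFin; injective⇒≤; splitAt-join)
open import Data.Fin.Subset.Properties using (∣p∣≤n)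
open import Data.Integer using (+_; +[1+_]; -[1+_])
import Data.Integer as ℤ
import Data.Integer.Properties as ℤ
open import Data.Nat using (ℕ; zero; suc; _+_; _*_; _^_; _≤_; _<_; _∸_; _%_; NonZero; >-nonZero; z≤n; s≤s)
import Data.Nat as ℕ
open import Data.Nat.DivMod using (m≡m%n+[m/n]*n; m%n<n)
open import Data.Nat.Properties
open import Data.Nat.Tactic.RingSolver using (solve-∀)
open import Data.Product using (∃; _×_; _,_; proj₁; proj₂)
open import Data.Rational using (0ℚ; 1ℚ; mkℚ; toℚᵘ; ↧ₙ_; _/_)
import Data.Rational as ℚ
import Data.Rational.Properties as ℚ
open import Data.Rational.Unnormalised using (*<*; *≤*)
import Data.Rational.Unnormalised as ℚᵘ
import Data.Rational.Unnormalised.Properties as ℚᵘ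
open import Data.Sum using (_⊎_; inj₁; inj₂)
open import Data.Sum.Properties using (inj₁-injective; inj₂-injective)
open import Function using (_∘_; Injective)
open import Function.Bundles using (Bijection; Injection; Inverse)
open import Function.Properties.Inverse using (↔⇒↣)
open import Level using (0ℓ)
open import Relation.Binary using (Setoid)
open import Relation.Binary.PropositionalEquality using (_≡_; refl; sym; trans; cong; cong₂; subst; subst₂; _≗_)
open import Relation.Nullary using (yes; no; contradiction)
open import Relation.Nullary.Decidable using (decidable-stable)

private
  variable
    m n : ℕ

-- Counting classes by injections into finite sets.

module _ {S : Setoid 0ℓ 0ℓ} (F : Finite S) where
  open Setoid S using (Carrier) renaming (_≈_ to _≈ˢ_)
  private module B = Bijection (proj₂ F)

  index : Carrier → Fin (card F)
  index x = proj₁ (B.surjective x)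

  represent : Fin (card F) → Carrier
  represent = B.to

  represent-index : ∀ x → represent (index x) ≈ˢ x
  represent-index x = proj₂ (B.surjective x) refl

  index-injective : ∀ {x y} → index x ≡ index y → x ≈ˢ y
  index-injective {x} {y} e = Setoid.trans S (Setoid.sym S (represent-index x))
    (Setoid.trans S (B.cong e) (represent-index y))

  -- `f` is evaluated at chosen, pairwise inequivalent representatives only. Thus it may differ on
  -- equivalent elements, as the degree sequence of a labelled graph does.
  card≤ : (f : Carrier → Fin n) → (∀ {x y} → f x ≡ f y → x ≈ˢ y) → card F ≤ n
  card≤ f f-inj = injective⇒≤ (λ e → B.injective (f-inj e))

join-injective : ∀ m n → Injective _≡_ _≡_ (join m n)
join-injective m n {x} {y} e =
  trans (sym (splitAt-join m n x)) (trans (cong (splitAt m) e) (splitAt-join m n y))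

funToFin-injective : {f g : Fin m → Fin n} → funToFin f ≡ funToFin g → f ≗ g
funToFin-injective {f = f} {g} e i = trans (sym (finToFun-funToFin f i))
  (trans (cong (λ c → finToFun c i) e) (finToFun-funToFin g i))

finToFun-injective : {i j : Fin (m ^ n)} → finToFun {m} {n} i ≗ finToFun j → i ≡ j
finToFun-injective {m} {n} {i} {j} e = trans (sym (funToFin-finToFin {n} {m} i))
  (trans (funToFin-cong e) (funToFin-finToFin {n} {m} j))
  where
  funToFin-cong : ∀ {n} {f g : Fin n → Fin m} → f ≗ g → funToFin f ≡ funToFin g
  funToFin-cong {zero}  e = refl
  funToFin-cong {suc n} e = cong₂ combine (e zero) (funToFin-cong (e ∘ suc))

count≤∣𝒢∣ : ∀ Q n → count Q n ≤ ∣𝒢∣ n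
count≤∣𝒢∣ Q n = card≤ (∩𝒢-finite Q n) (index (𝒢-finite n) ∘ proj₁) (index-injective (𝒢-finite n))

-- Deciding whether a mate exists sends each graph to the index of its class on one of two sides.
-- This turns scarcity of `Deg`-unique classes into abundance of classes with a mate.
∣𝒢∣≤mate+unique : ∀ n → ∣𝒢∣ n ≤ count hasDegMate n + ∣U-Deg∣ n
∣𝒢∣≤mate+unique n = card≤ (𝒢-finite n) (join _ _ ∘ side) (side-injective ∘ join-injective _ _)
  where
  M = ∩𝒢-finite hasDegMate n
  U = ∩𝒢-finite isDegUnique n

  side : Graph n → Fin (card M) ⊎ Fin (card U)
  side G with hasDegMate? G
  ... | yes h = inj₁ (index M (G , h))
  ... | no u  = inj₂ (index U (G , u))

  side-injective : ∀ {G H} → side G ≡ side H → G ≅ H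
  side-injective {G} {H} e with hasDegMate? G | hasDegMate? H
  ... | yes _ | yes _ = index-injective M (inj₁-injective e)
  ... | no _  | no _  = index-injective U (inj₂-injective e)
  ... | yes _ | no _  = contradiction e λ ()
  ... | no _  | yes _ = contradiction e λ ()

-- Upper bound for the `Deg`-unique classes.

degreeSequence : Graph n → Fin n → Fin (suc n)
degreeSequence G v = fromℕ< (s≤s (∣p∣≤n (neighbours G v)))

degreeSequence⇒Deg : (G H : Graph n) → degreeSequence G ≗ degreeSequence H → ⟦ Deg ⟧ G ≈ ⟦ Deg ⟧ H
degreeSequence⇒Deg G H e = CommutativeMonoid.reflexive ⊕-commutativeMonoid
  (sum-cong-≗ ⊕-commutativeMonoid λ v → cong x^_ (deg≡ v))
  where
  deg≡ : ∀ v → deg G v ≡ deg H v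
  deg≡ v = fromℕ<-injective _ _ (s≤s (∣p∣≤n (neighbours G v))) (s≤s (∣p∣≤n (neighbours H v))) (e v)

-- If `H` were not isomorphic to `G`, it would be a mate of `G`; decidability of `≅` removes the
-- double negation.
unique-≅ : {G H : Graph n} → IsUnique Deg G → ⟦ Deg ⟧ G ≈ ⟦ Deg ⟧ H → G ≅ H
unique-≅ {G = G} {H} u e = decidable-stable (G ≅? H) λ ¬i → u (_ , H , e , ¬i ∘ ≅-sym)

∣U-Deg∣≤ : ∀ n → ∣U-Deg∣ n ≤ suc n ^ n
∣U-Deg∣≤ n = card≤ (∩𝒢-finite isDegUnique n) (funToFin ∘ degreeSequence ∘ proj₁)
  λ {(G , u)} {(H , _)} e → unique-≅ u (degreeSequence⇒Deg G H (funToFin-injective e))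

-- Lower bound for the number of classes.

extend : (Fin n → Bool) → Graph n → Graph (suc n)
extend {n} r G = record { adj = adj′ ; symmetric = symmetric′ ; loopless = loopless′ }
  where
  adj′ : Fin (suc n) → Fin (suc n) → Bool
  adj′ zero    zero    = false
  adj′ zero    (suc v) = r v
  adj′ (suc u) zero    = r u
  adj′ (suc u) (suc v) = adj G u v

  symmetric′ : ∀ u v → adj′ u v ≡ adj′ v u
  symmetric′ zero    zero    = refl
  symmetric′ zero    (suc v) = refl
  symmetric′ (suc u) zero    = refl
  symmetric′ (suc u) (suc v) = symmetric G u v

  loopless′ : ∀ v → adj′ v v ≡ false
  loopless′ zero    = refl
  loopless′ (suc v) = loopless G v

-- The factor `2 ^ n` counts the neighbourhoods of a new vertex, so that `labelled` can split a code
-- by quotient and remainder.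
#labelled : ℕ → ℕ
#labelled zero    = 1
#labelled (suc n) = 2 ^ n * #labelled n

labelled : ∀ n → Fin (#labelled n) → Graph n
labelled zero    _ = emptyGraph 0
labelled (suc n) c = extend (Inverse.to 2↔Bool ∘ finToFun (quotient {2 ^ n} (#labelled n) c))
                            (labelled n (remainder {2 ^ n} (#labelled n) c))

labelled-injective : ∀ n {c d} → (∀ u v → adj (labelled n c) u v ≡ adj (labelled n d) u v) → c ≡ d
labelled-injective zero    {zero} {zero} e = refl
labelled-injective (suc n) {c} {d} e =
  trans (sym (combine-remQuot {2 ^ n} (#labelled n) c))
    (trans (cong₂ combine
             (finToFun-injective λ v → Injection.injective (↔⇒↣ 2↔Bool) (e zero (suc v)))
             (labelled-injective n λ u v → e (suc u) (suc v)))
      (combine-remQuot {2 ^ n} (#labelled n) d))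

-- Pulling the representative's adjacency back along `vertexMap` recovers the labelled graph.
-- Bijections are coded as arbitrary maps, which gives `n ^ n` in place of n!.
#labelled≤ : ∀ n → #labelled n ≤ ∣𝒢∣ n * n ^ n
#labelled≤ n = injective⇒≤ {f = code} λ {c} {d} e →
  let e₁ , e₂ = combine-injective (class c) (funToFin (vertexMap c)) (class d) (funToFin (vertexMap d)) e
  in labelled-injective n λ u v → trans (adj-pres (iso c) u v)
       (trans (cong₂ (adj (represent F (class c))) (funToFin-injective e₂ u) (funToFin-injective e₂ v))
         (trans (cong (λ i → adj (represent F i) _ _) e₁) (sym (adj-pres (iso d) u v))))
  where
  F = 𝒢-finite n

  class : Fin (#labelled n) → Fin (∣𝒢∣ n)
  class c = index F (labelled n c)

  iso : ∀ c → labelled n c ≅ represent F (class c)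
  iso c = ≅-sym (represent-index F (labelled n c))

  vertexMap : Fin (#labelled n) → Fin n → Fin n
  vertexMap c = bij (iso c) ⟨$⟩ʳ_

  code : Fin (#labelled n) → Fin (∣𝒢∣ n * n ^ n)
  code c = combine (class c) (funToFin (vertexMap c))

-- Comparison of the two bounds.

triangle : ℕ → ℕ
triangle zero    = 0
triangle (suc n) = n + triangle n

#labelled≡2^ : ∀ n → #labelled n ≡ 2 ^ triangle n
#labelled≡2^ zero    = refl
#labelled≡2^ (suc n) = trans (cong (2 ^ n *_) (#labelled≡2^ n)) (sym (^-distribˡ-+-* 2 n (triangle n)))

2*triangle+n≡n*n : ∀ n → 2 * triangle n + n ≡ n * n
2*triangle+n≡n*n zero    = refl
2*triangle+n≡n*n (suc n) = trans (lemma n (triangle n)) (trans (cong (_+ (2 * n + 1)) (2*triangle+n≡n*n n)) (lemma′ n))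
  where
  lemma : ∀ n t → 2 * (n + t) + suc n ≡ 2 * t + n + (2 * n + 1)
  lemma = solve-∀
  lemma′ : ∀ n → n * n + (2 * n + 1) ≡ suc n * suc n
  lemma′ = solve-∀

-- The right side doubles while the left grows by 4. The constants fit `logarithm`, where `n` is at
-- most 25 + 4j and the exponent is 5 + j.
linear≤2^ : ∀ j → 26 + 4 * j ≤ 2 ^ (5 + j)
linear≤2^ zero    = m≤m+n 26 6
linear≤2^ (suc j) = begin
  26 + 4 * suc j                ≤⟨ m≤m+n _ (22 + 4 * j) ⟩
  26 + 4 * suc j + (22 + 4 * j) ≡⟨ lemma j ⟩
  2 * (26 + 4 * j)              ≤⟨ *-monoʳ-≤ 2 (linear≤2^ j) ⟩
  2 ^ (5 + suc j)               ∎
  where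
  open ≤-Reasoning
  lemma : ∀ j → 26 + 4 * suc j + (22 + 4 * j) ≡ 2 * (26 + 4 * j)
  lemma = solve-∀

-- The witness is k = ⌊(n - 2) / 4⌋, and 22 is the least n for which it is at least 5.
logarithm : ∀ n → 22 ≤ n → ∃ λ k → suc n ≤ 2 ^ k × 4 * k + 2 ≤ n
logarithm n 22≤n = 5 + j , upper , lower
  where
  open ≤-Reasoning
  r = (n ∸ 22) % 4
  j = (n ∸ 22) ℕ./ 4

  n≡ : n ≡ 22 + (r + j * 4)
  n≡ = trans (sym (m+[n∸m]≡n 22≤n)) (cong (λ z → 22 + z) (m≡m%n+[m/n]*n (n ∸ 22) 4))

  upper : suc n ≤ 2 ^ (5 + j)
  upper = begin
    suc n                  ≡⟨ cong suc n≡ ⟩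
    23 + (r + j * 4)       ≤⟨ +-monoʳ-≤ 23 (+-monoˡ-≤ (j * 4) (≤-pred (m%n<n (n ∸ 22) 4))) ⟩
    26 + j * 4             ≡⟨ cong (λ z → 26 + z) (*-comm j 4) ⟩
    26 + 4 * j             ≤⟨ linear≤2^ j ⟩
    2 ^ (5 + j)            ∎

  lemma : ∀ j → 4 * (5 + j) + 2 ≡ 22 + j * 4
  lemma = solve-∀

  lower : 4 * (5 + j) + 2 ≤ n
  lower = begin
    4 * (5 + j) + 2        ≡⟨ lemma j ⟩
    22 + j * 4             ≤⟨ +-monoʳ-≤ 22 (m≤n+m (j * 4) r) ⟩
    22 + (r + j * 4)       ≡⟨ n≡ ⟨
    n                      ∎

-- Doubling and adding `n` turns the right side into `n * n` and the left into 4kn + n + 2k, which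
-- is at most (4k + 2)n because 2k is at most `n`.
exponent≤triangle : ∀ k n → 4 * k + 2 ≤ n → k * n + k + k * n ≤ triangle n
exponent≤triangle k n h = *-cancelˡ-≤ 2 (+-cancelʳ-≤ n _ _ (begin
  2 * (k * n + k + k * n) + n ≡⟨ lemma k n ⟩
  4 * k * n + n + 2 * k       ≤⟨ +-monoʳ-≤ (4 * k * n + n) 2k≤n ⟩
  4 * k * n + n + n           ≡⟨ lemma′ k n ⟩
  (4 * k + 2) * n             ≤⟨ *-monoˡ-≤ n h ⟩
  n * n                       ≡⟨ 2*triangle+n≡n*n n ⟨
  2 * triangle n + n          ∎))
  where
  open ≤-Reasoning
  lemma : ∀ k n → 2 * (k * n + k + k * n) + n ≡ 4 * k * n + n + 2 * k
  lemma = solve-∀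
  lemma′ : ∀ k n → 4 * k * n + n + n ≡ (4 * k + 2) * n
  lemma′ = solve-∀
  2k≤n : 2 * k ≤ n
  2k≤n = ≤-trans (*-monoˡ-≤ k (m≤m+n 2 2)) (≤-trans (m≤m+n (4 * k) 2) h)

sequences*maps<2^triangle : ∀ k q n .{{_ : NonZero n}} → suc n ≤ 2 ^ k → 4 * k + 2 ≤ n → q ≤ n →
  suc n ^ n * q * n ^ n < 2 ^ triangle n
sequences*maps<2^triangle k q n n<2^k h q≤n = begin-strict
  -- Strictness enters here: `q` is below `suc n`, and the other factors are positive.
  suc n ^ n * q * n ^ n             <⟨ *-monoˡ-< (n ^ n) {{m^n≢0 n n}} (*-monoʳ-< (suc n ^ n) {{m^n≢0 (suc n) n}} (s≤s q≤n)) ⟩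
  suc n ^ n * suc n * n ^ n         ≤⟨ *-mono-≤ (*-mono-≤ (power≤ n<2^k) n<2^k) (power≤ (<⇒≤ n<2^k)) ⟩
  2 ^ (k * n) * 2 ^ k * 2 ^ (k * n) ≡⟨ cong (_* 2 ^ (k * n)) (^-distribˡ-+-* 2 (k * n) k) ⟨
  2 ^ (k * n + k) * 2 ^ (k * n)     ≡⟨ ^-distribˡ-+-* 2 (k * n + k) (k * n) ⟨
  2 ^ (k * n + k + k * n)           ≤⟨ ^-monoʳ-≤ 2 (exponent≤triangle k n h) ⟩
  2 ^ triangle n                    ∎
  where
  open ≤-Reasoning
  power≤ : ∀ {a} → a ≤ 2 ^ k → a ^ n ≤ 2 ^ (k * n)
  power≤ a≤ = ≤-trans (^-monoˡ-≤ n a≤) (≤-reflexive (^-*-assoc 2 k n))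

-- For positive `q` this puts the proportion of `Deg`-unique classes below 1/q; `q` will be the
-- denominator of the tolerance. Both sides are multiplied by `n ^ n`, the factor lost in
-- `#labelled≤`.
unique-rare : ∀ q n → 22 ≤ n → q ≤ n → ∣U-Deg∣ n * q < ∣𝒢∣ n
unique-rare q n 22≤n q≤n = let k , n<2^k , h = logarithm n 22≤n in
  *-cancelʳ-< (n ^ n) _ _ (begin-strict
  ∣U-Deg∣ n * q * n ^ n   ≤⟨ *-monoˡ-≤ (n ^ n) (*-monoˡ-≤ q (∣U-Deg∣≤ n)) ⟩
  suc n ^ n * q * n ^ n   <⟨ sequences*maps<2^triangle k q n {{>-nonZero (≤-trans (s≤s z≤n) 22≤n)}} n<2^k h q≤n ⟩
  2 ^ triangle n          ≡⟨ #labelled≡2^ n ⟨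
  #labelled n             ≤⟨ #labelled≤ n ⟩
  ∣𝒢∣ n * n ^ n           ∎)
  where open ≤-Reasoning

-- From natural number bounds to rational limits.

toℚᵘ-/ : ∀ a b .{{_ : NonZero b}} → toℚᵘ (+ a / b) ℚᵘ.≃ + a ℚᵘ./ b
toℚᵘ-/ a (suc b) = ℚ.toℚᵘ-fromℚᵘ (ℚᵘ.mkℚᵘ (+ a) b)

-- A positive rational has numerator at least 1, so it is at least the reciprocal of its
-- denominator.
/-<-ε : ∀ a b .{{_ : NonZero b}} ε → 0ℚ ℚ.< ε → a * ↧ₙ ε < b → + a / b ℚ.< ε
/-<-ε a b       (mkℚ (+ 0)    d c) (ℚ.*<* (ℤ.+<+ ())) _
/-<-ε a b       (mkℚ -[1+ p ] d c) (ℚ.*<* ()) _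
/-<-ε a (suc b) (mkℚ +[1+ p ] d c) _ h = ℚ.toℚᵘ-cancel-<
  (ℚᵘ.<-respˡ-≃ (ℚᵘ.≃-sym (toℚᵘ-/ a (suc b)))
    (*<* (subst₂ ℤ._<_ (ℤ.pos-* a (suc d)) (ℤ.pos-* (suc p) (suc b))
      (ℤ.+<+ (<-≤-trans h (m≤m+n (suc b) (p * suc b)))))))

0≤/ : ∀ a b .{{_ : NonZero b}} → 0ℚ ℚ.≤ + a / b
0≤/ a (suc b) = ℚ.toℚᵘ-cancel-≤ (ℚᵘ.≤-respʳ-≃ (ℚᵘ.≃-sym (toℚᵘ-/ a (suc b)))
  (*≤* (subst (+ 0 ℤ.≤_) (ℤ.pos-* a 1) (ℤ.+≤+ z≤n))))

/≤1 : ∀ a b .{{_ : NonZero b}} → a ≤ b → + a / b ℚ.≤ 1ℚ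
/≤1 a (suc b) a≤b = ℚ.toℚᵘ-cancel-≤ (ℚᵘ.≤-respˡ-≃ (ℚᵘ.≃-sym (toℚᵘ-/ a (suc b)))
  (*≤* (subst₂ ℤ._≤_ (ℤ.pos-* a 1) (ℤ.pos-* 1 (suc b)) (ℤ.+≤+ (subst₂ _≤_ (sym (*-identityʳ a)) (sym (*-identityˡ (suc b))) a≤b)))))

1≤/+/ : ∀ a c b .{{_ : NonZero b}} → b ≤ a + c → 1ℚ ℚ.≤ + a / b ℚ.+ + c / b
1≤/+/ a c (suc b) b≤a+c = ℚ.toℚᵘ-cancel-≤ (ℚᵘ.≤-respʳ-≃
  (ℚᵘ.≃-sym (ℚᵘ.≃-trans (ℚ.toℚᵘ-homo-+ (+ a / suc b) (+ c / suc b))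
    (ℚᵘ.+-cong (toℚᵘ-/ a (suc b)) (toℚᵘ-/ c (suc b)))))
  -- The unnormalised sum has denominator `suc b * suc b`, so the hypothesis is used multiplied by
  -- `suc b`.
  (*≤* (begin
    + 1 ℤ.* + (suc b * suc b)                     ≡⟨ ℤ.*-identityˡ _ ⟩
    + (suc b * suc b)                             ≤⟨ ℤ.+≤+ (*-monoˡ-≤ (suc b) b≤a+c) ⟩
    + ((a + c) * suc b)                           ≡⟨ ℤ.pos-* (a + c) (suc b) ⟩
    (+ a ℤ.+ + c) ℤ.* + suc b                     ≡⟨ ℤ.*-distribʳ-+ (+ suc b) (+ a) (+ c) ⟩
    + a ℤ.* + suc b ℤ.+ + c ℤ.* + suc b           ≡⟨ ℤ.*-identityʳ _ ⟨
    (+ a ℤ.* + suc b ℤ.+ + c ℤ.* + suc b) ℤ.* + 1 ∎)))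
  where open ℤ.≤-Reasoning

-- As a/b is at most 1, the absolute value is 1 - a/b. With `a` counting classes with a mate and `c`
-- the unique ones, the first limit follows from the second.
∣/-1∣≤/ : ∀ a c b .{{_ : NonZero b}} → a ≤ b → b ≤ a + c → ℚ.∣ + a / b ℚ.- 1ℚ ∣ ℚ.≤ + c / b
∣/-1∣≤/ a c b a≤b b≤a+c = begin
  ℚ.∣ p ℚ.- 1ℚ ∣       ≡⟨ ℚ.∣-p∣≡∣p∣ (p ℚ.- 1ℚ) ⟨
  ℚ.∣ ℚ.- (p ℚ.- 1ℚ) ∣ ≡⟨ cong ℚ.∣_∣ (⁻¹-anti-homo-// p 1ℚ) ⟩
  ℚ.∣ 1ℚ ℚ.- p ∣       ≡⟨ ℚ.0≤p⇒∣p∣≡p (subst (ℚ._≤ 1ℚ ℚ.- p) (ℚ.+-inverseʳ p) (ℚ.+-monoˡ-≤ (ℚ.- p) (/≤1 a b a≤b))) ⟩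
  1ℚ ℚ.- p             ≤⟨ ℚ.+-monoˡ-≤ (ℚ.- p) (1≤/+/ a c b b≤a+c) ⟩
  p ℚ.+ q ℚ.- p        ≡⟨ xyx⁻¹≈y p q ⟩
  q                    ∎
  where
  open ℚ.≤-Reasoning
  open import Algebra.Properties.AbelianGroup ℚ.+-0-abelianGroup using (⁻¹-anti-homo-//; xyx⁻¹≈y)
  p = + a / b
  q = + c / b

theorem1 : AlmostAll hasDegMate × ((λ n → _/_ (+ ∣U-Deg∣ n) (∣𝒢∣ n) {{∣𝒢∣-nonZero n}}) ⟶ 0ℚ)
theorem1 =
  -- The sum ensures both conditions of `unique-rare`: `n` is at least 22 and at least the
  -- denominator of `ε`.
  (λ ε 0<ε → 22 + ↧ₙ ε , λ n N≤n → ℚ.≤-<-trans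
    (∣/-1∣≤/ (count hasDegMate n) (∣U-Deg∣ n) (∣𝒢∣ n) {{∣𝒢∣-nonZero n}}
      (count≤∣𝒢∣ hasDegMate n) (∣𝒢∣≤mate+unique n))
    (unique-small ε 0<ε n N≤n)) ,
  (λ ε 0<ε → 22 + ↧ₙ ε , λ n N≤n → subst (ℚ._< ε)
    (sym (trans (cong ℚ.∣_∣ (ℚ.+-identityʳ _)) (ℚ.0≤p⇒∣p∣≡p (0≤/ (∣U-Deg∣ n) (∣𝒢∣ n) {{∣𝒢∣-nonZero n}}))))
    (unique-small ε 0<ε n N≤n))
  where
  unique-small : ∀ ε → 0ℚ ℚ.< ε → ∀ n → 22 + ↧ₙ ε ≤ n →
                 _/_ (+ ∣U-Deg∣ n) (∣𝒢∣ n) {{∣𝒢∣-nonZero n}} ℚ.< ε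
  unique-small ε 0<ε n N≤n = /-<-ε (∣U-Deg∣ n) (∣𝒢∣ n) {{∣𝒢∣-nonZero n}} ε 0<ε
    (unique-rare (↧ₙ ε) n (m+n≤o⇒m≤o 22 N≤n) (m+n≤o⇒n≤o 22 N≤n))
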